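{- Let $n$ be a positive integer. A linear map $\phi: S_n^+\rightarrow S_n^+$ satisfies $$\alpha(\phi(X))=\alpha(X)\quad\text{for all } X\in S_n^+$$ if and only if all off-diagonal entries of the matrix $H:=\phi(J_n-I_n)$ are positive and there is an $n\times n$ permutation matrix $P$ such that $$\phi(X)=H\circ(P^TXP)\quad\text{for all } X\in S_n^+.$$
   Context: $S_n^+$ is the set of $n\times n$ (entrywise) nonnegative real symmetric matrices with zero trace (so all diagonal entries are zero). A map $\phi:S_n^+\to S_n^+$ is linear if $\phi(aX+bY)=a\phi(X)+b\phi(Y)$ for all $X,Y\in S_n^+$ and all real $a,b\ge 0$. The independence number $\alpha(A)$ of a square matrix $A$ is the maximum order of its principal zero submatrices. $J_n$ is the $n\times n$ all-ones matrix, $I_n$ is the identity matrix, and $A\circ B$ is the Hadamard (entrywise) product. -}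

module Defs where

open import Level using (suc; _⊔_)
open import Algebra.Core using (Op₁; Op₂)
open import Algebra.Bundles using (CommutativeRing)
open import Algebra.Structures using (IsCommutativeRing)
import Algebra.Properties.Ring as RingProperties
import Algebra.Properties.Semiring.Sum as SemiringSum
open import Data.Bool.Base using (if_then_else_)
open import Data.Fin.Base using (Fin)
open import Data.Fin.Permutation using (Permutation′; _⟨$⟩ʳ_)
import Data.Fin.Properties as Fin
open import Data.Fin.Subset using (Subset; _∈_; ∣_∣; ⊥)
open import Data.Fin.Subset.Properties using (_∈?_; ∉⊥; anySubset?; ∣p∣≤n; ∣⊥∣≡0)
open import Data.Nat.Base as ℕ using (ℕ)
import Data.Nat.Properties as ℕ
open import Data.Product.Base using (∃; _×_; _,_; proj₁)
open import Data.Sum.Base using (inj₁; inj₂)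
open import Data.Vec.Functional using (Vector)
open import Function.Bundles using (Func)
open import Relation.Binary.Bundles using (Setoid)
open import Relation.Binary.Core using (Rel)
import Relation.Binary.Construct.NonStrictToStrict as ToStrict
open import Relation.Binary.PropositionalEquality as ≡ using (_≡_)
open import Relation.Binary.Structures using (IsDecTotalOrder)
open import Relation.Nullary using (¬_; Dec; yes; no; does; contradiction)
open import Relation.Nullary.Decidable using (_×-dec_; _→-dec_; dec-true)
open import Relation.Unary using (Pred; Satisfiable)

-- The classical real numbers, given axiomatically as a Dedekind-complete
-- ordered field.  These axioms determine the reals up to isomorphism; the order
-- (hence equality) is decidable, as it is in classical mathematics.  Constructing
-- a model in Agda requires excluded middle.
record RealNumbers c ℓ₁ ℓ₂ : Set (suc (c ⊔ ℓ₁ ⊔ ℓ₂)) where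
  infix  8 -_
  infixl 7 _*_
  infixl 6 _+_
  infix  4 _≈_ _≤_ _<_
  field
    Carrier           : Set c
    _≈_               : Rel Carrier ℓ₁
    _≤_               : Rel Carrier ℓ₂
    _+_ _*_           : Op₂ Carrier
    -_                : Op₁ Carrier
    0# 1#             : Carrier
    isCommutativeRing : IsCommutativeRing _≈_ _+_ _*_ -_ 0# 1#
    isDecTotalOrder   : IsDecTotalOrder _≈_ _≤_

    0≉1               : ¬ (0# ≈ 1#)
    inverse           : ∀ x → ¬ (x ≈ 0#) → ∃ λ y → x * y ≈ 1#

    +-monoʳ-≤         : ∀ z {x y} → x ≤ y → z + x ≤ z + y
    *-nonNegative     : ∀ {x y} → 0# ≤ x → 0# ≤ y → 0# ≤ x * y

  IsUpperBound : ∀ {p} → Pred Carrier p → Carrier → Set (c ⊔ ℓ₂ ⊔ p)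
  IsUpperBound P u = ∀ x → P x → x ≤ u

  IsSupremum : ∀ {p} → Pred Carrier p → Carrier → Set (c ⊔ ℓ₂ ⊔ p)
  IsSupremum P s = IsUpperBound P s × (∀ u → IsUpperBound P u → s ≤ u)

  field
    complete : ∀ (P : Pred Carrier (c ⊔ ℓ₁ ⊔ ℓ₂)) →
               Satisfiable P → ∃ (IsUpperBound P) → ∃ (IsSupremum P)

  _<_ : Rel Carrier (ℓ₁ ⊔ ℓ₂)
  _<_ = ToStrict._<_ _≈_ _≤_

  commutativeRing : CommutativeRing c ℓ₁
  commutativeRing = record { isCommutativeRing = isCommutativeRing }

  open CommutativeRing commutativeRing public
    hiding (Carrier; _≈_; _+_; _*_; -_; 0#; 1#; isCommutativeRing)

  open IsDecTotalOrder isDecTotalOrder public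
    using (_≟_; _≤?_; total; antisym; ≤-respˡ-≈; ≤-respʳ-≈)
    renaming (refl to ≤-refl; trans to ≤-trans; reflexive to ≤-reflexive)

  +-nonNegative : ∀ {x y} → 0# ≤ x → 0# ≤ y → 0# ≤ x + y
  +-nonNegative {x} 0≤x 0≤y =
    ≤-trans 0≤x (≤-respˡ-≈ (+-identityʳ x) (+-monoʳ-≤ x 0≤y))

  0≤1 : 0# ≤ 1#
  0≤1 with total 0# 1#
  ... | inj₁ 0≤1 = 0≤1
  ... | inj₂ 1≤0 = ≤-respʳ-≈ [-1]²≈1 (*-nonNegative 0≤-1 0≤-1)
    where
    open RingProperties ring using (-‿distribˡ-*; -‿involutive)
    0≤-1 : 0# ≤ - 1#
    0≤-1 = ≤-respʳ-≈ (+-identityʳ _)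
             (≤-respˡ-≈ (-‿inverseˡ 1#) (+-monoʳ-≤ (- 1#) 1≤0))
    [-1]²≈1 : - 1# * - 1# ≈ 1#
    [-1]²≈1 = trans (sym (-‿distribˡ-* 1# (- 1#)))
                (trans (-‿cong (*-identityˡ (- 1#))) (-‿involutive 1#))

module RealMatrices {c ℓ₁ ℓ₂} (ℝ : RealNumbers c ℓ₁ ℓ₂) where

  open RealNumbers ℝ
  open SemiringSum semiring

  Matrix : ℕ → ℕ → Set c
  Matrix m n = Vector (Vector Carrier n) m

  infix  4 _≈ₘ_
  infixl 6 _+ₘ_ _-ₘ_
  infixl 7 _*ₘ_ _∘ₘ_
  infixr 8 _·ₘ_
  infix  9 _ᵀ

  _≈ₘ_ : ∀ {m n} → Rel (Matrix m n) ℓ₁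
  A ≈ₘ B = ∀ i j → A i j ≈ B i j

  _+ₘ_ : ∀ {m n} → Op₂ (Matrix m n)
  (A +ₘ B) i j = A i j + B i j

  _-ₘ_ : ∀ {m n} → Op₂ (Matrix m n)
  (A -ₘ B) i j = A i j - B i j

  _·ₘ_ : ∀ {m n} → Carrier → Matrix m n → Matrix m n
  (a ·ₘ A) i j = a * A i j

  _*ₘ_ : ∀ {l m n} → Matrix l m → Matrix m n → Matrix l n
  _*ₘ_ {m = m} A B i k = ∑[ j < m ] (A i j * B j k)

  -- Hadamard product
  _∘ₘ_ : ∀ {m n} → Op₂ (Matrix m n)
  (A ∘ₘ B) i j = A i j * B i j

  _ᵀ : ∀ {m n} → Matrix m n → Matrix n m
  (A ᵀ) i j = A j i

  trace : ∀ {n} → Matrix n n → Carrier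
  trace {n} A = ∑[ i < n ] A i i

  δ : ∀ {n} → Fin n → Fin n → Carrier
  δ i j = if does (i Fin.≟ j) then 1# else 0#

  J : ∀ n → Matrix n n
  J n i j = 1#

  I : ∀ n → Matrix n n
  I n = δ

  IsPermutationMatrix : ∀ {n} → Matrix n n → Set ℓ₁
  IsPermutationMatrix {n} P =
    ∃ λ (σ : Permutation′ n) → ∀ i j → P i j ≈ δ (σ ⟨$⟩ʳ i) j

  -- The principal submatrix of A with row and column index set S is zero.
  IsZeroPrincipal : ∀ {n} → Matrix n n → Subset n → Set ℓ₁
  IsZeroPrincipal A S = ∀ i j → i ∈ S → j ∈ S → A i j ≈ 0#

  -- The order of the principal submatrix on S is ∣ S ∣.  The empty submatrix
  -- counts as zero of order 0, which matters only if no diagonal entry vanishes.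
  IsIndependenceNumber : ∀ {n} → Matrix n n → ℕ → Set ℓ₁
  IsIndependenceNumber A k =
    (∃ λ S → IsZeroPrincipal A S × ∣ S ∣ ≡ k) ×
    (∀ S → IsZeroPrincipal A S → ∣ S ∣ ℕ.≤ k)

  isZeroPrincipal? : ∀ {n} (A : Matrix n n) S → Dec (IsZeroPrincipal A S)
  isZeroPrincipal? A S = Fin.all? λ i → Fin.all? λ j →
    (i ∈? S) →-dec ((j ∈? S) →-dec (A i j ≟ 0#))

  independenceNumber : ∀ {n} (A : Matrix n n) → ∃ (IsIndependenceNumber A)
  independenceNumber {n} A = search n (λ S _ → ∣p∣≤n S)
    where
    search : ∀ k → (∀ S → IsZeroPrincipal A S → ∣ S ∣ ℕ.≤ k) →
             ∃ (IsIndependenceNumber A)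
    search k bound
      with anySubset? (λ S → isZeroPrincipal? A S ×-dec (∣ S ∣ ℕ.≟ k))
    ... | yes found = k , found , bound
    search ℕ.zero bound | no ¬found =
      contradiction (⊥ , (λ i j i∈⊥ → contradiction i∈⊥ ∉⊥) , ∣⊥∣≡0 n) ¬found
    search (ℕ.suc k) bound | no ¬found =
      search k λ S zeroS → ℕ.s≤s⁻¹
        (ℕ.≤∧≢⇒< (bound S zeroS) λ ∣S∣≡1+k → ¬found (S , zeroS , ∣S∣≡1+k))

  α : ∀ {n} → Matrix n n → ℕ
  α A = proj₁ (independenceNumber A)

  record S⁺ (n : ℕ) : Set (c ⊔ ℓ₁ ⊔ ℓ₂) where
    field
      matrix      : Matrix n n
      nonNegative : ∀ i j → 0# ≤ matrix i j
      symmetric   : matrix ≈ₘ matrix ᵀ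
      zeroTrace   : trace matrix ≈ 0#

  open S⁺ public

  S⁺-setoid : ℕ → Setoid (c ⊔ ℓ₁ ⊔ ℓ₂) ℓ₁
  S⁺-setoid n = record
    { Carrier       = S⁺ n
    ; _≈_           = λ X Y → matrix X ≈ₘ matrix Y
    ; isEquivalence = record
      { refl  = λ i j → refl
      ; sym   = λ X≈Y i j → sym (X≈Y i j)
      ; trans = λ X≈Y Y≈Z i j → trans (X≈Y i j) (Y≈Z i j)
      }
    }

  -- a X + b Y for a , b ≥ 0
  conic : ∀ {n a b} → 0# ≤ a → 0# ≤ b → S⁺ n → S⁺ n → S⁺ n
  conic {n} {a} {b} 0≤a 0≤b X Y = record
    { matrix      = a ·ₘ matrix X +ₘ b ·ₘ matrix Y
    ; nonNegative = λ i j → +-nonNegative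
        (*-nonNegative 0≤a (nonNegative X i j))
        (*-nonNegative 0≤b (nonNegative Y i j))
    ; symmetric   = λ i j →
        +-cong (*-congˡ (symmetric X i j)) (*-congˡ (symmetric Y i j))
    ; zeroTrace   = trans
        (∑-distrib-+ (λ i → a * matrix X i i) (λ i → b * matrix Y i i))
        (trans (+-cong (scaled a X) (scaled b Y)) (+-identityʳ 0#))
    }
    where
    scaled : ∀ r (Z : S⁺ n) → ∑[ i < n ] (r * matrix Z i i) ≈ 0#
    scaled r Z = trans (sym (*-distribˡ-sum r (λ i → matrix Z i i)))
                   (trans (*-congˡ (zeroTrace Z)) (zeroʳ r))

  J-I : ∀ n → S⁺ n
  J-I n = record
    { matrix      = J n -ₘ I n
    ; nonNegative = nonNeg
    ; symmetric   = λ i j → +-congˡ (-‿cong (reflexive (δ-sym i j)))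
    ; zeroTrace   = trans (sum-cong-≋ {n} diag) (sum-replicate-zero n)
    }
    where
    nonNeg : ∀ i j → 0# ≤ 1# - δ i j
    nonNeg i j with i Fin.≟ j
    ... | yes _ = ≤-reflexive (sym (-‿inverseʳ 1#))
    ... | no  _ = +-nonNegative 0≤1
                    (≤-reflexive (trans (sym (-‿inverseʳ 0#)) (+-identityˡ (- 0#))))

    δ-sym : ∀ (i j : Fin n) → δ i j ≡ δ j i
    δ-sym i j with i Fin.≟ j | j Fin.≟ i
    ... | yes _   | yes _   = ≡.refl
    ... | no _    | no _    = ≡.refl
    ... | yes i≡j | no j≢i  = contradiction (≡.sym i≡j) j≢i
    ... | no i≢j  | yes j≡i = contradiction (≡.sym j≡i) i≢j

    diag : ∀ i → 1# - δ i i ≈ 0#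
    diag i rewrite dec-true (i Fin.≟ i) ≡.refl = -‿inverseʳ 1#

  S⁺-Map : ℕ → Set (c ⊔ ℓ₁ ⊔ ℓ₂)
  S⁺-Map n = Func (S⁺-setoid n) (S⁺-setoid n)

  infix 10 _⟦_⟧

  _⟦_⟧ : ∀ {n} → S⁺-Map n → S⁺ n → Matrix n n
  φ ⟦ X ⟧ = matrix (Func.to φ X)

  IsLinear : ∀ {n} → S⁺-Map n → Set (c ⊔ ℓ₁ ⊔ ℓ₂)
  IsLinear φ = ∀ X Y {a b} (0≤a : 0# ≤ a) (0≤b : 0# ≤ b) →
    φ ⟦ conic 0≤a 0≤b X Y ⟧ ≈ₘ a ·ₘ φ ⟦ X ⟧ +ₘ b ·ₘ φ ⟦ Y ⟧

{-# OPTIONS --safe #-}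

-- The image of a star with centre u has independence number at least n − 1, so all
-- its edges pass through one vertex σ u.  For n ≥ 3 the map σ is injective: if
-- σ u = σ v with u ≠ v, then the image of the union of the two stars would have
-- independence number at least n − 1, whereas the union contains a triangle.  The
-- edge uv lies in both stars, so φ maps its matrix E to a matrix supported on the
-- edge σu σv.  If X vanishes at uv then φ X vanishes at σu σv: add to X the
-- complete graph without uv; the image of the sum has an independent pair, and
-- this pair can only be {σu , σv}.  Splitting X into X u v · E and the rest now
-- gives (φ X)(σu , σv) = X(u , v) · (φ E)(σu , σv).  For n ≤ 2 there is at most one
-- edge, and σ is the identity.
module Submission where

open import Defs
import Algebra.Properties.CommutativeMonoid.Sum as CommutativeMonoidSum
import Algebra.Properties.Semiring.Sum as SemiringSum
open import Data.Bool.Base using (if_then_else_)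
open import Data.Fin.Base using (Fin; zero; suc; punchIn; punchOut)
open import Data.Fin.Patterns using (0F; 1F)
open import Data.Fin.Permutation as Perm
  using (Permutation′; permutation; _⟨$⟩ʳ_; _⟨$⟩ˡ_; inverseˡ; inverseʳ)
import Data.Fin.Properties as Fin
open import Data.Fin.Subset
  using (Subset; _∈_; _∉_; _⊆_; ∣_∣; ⊤; ⁅_⁆; ∁; _∪_; inside; outside)
  renaming (_-_ to _∖_)
open import Data.Fin.Subset.Properties
open import Data.Nat.Base as ℕ using (ℕ; NonZero)
import Data.Nat.Properties as ℕ
open import Data.Product.Base using (∃; ∃₂; _×_; _,_; proj₁; proj₂)
open import Data.Sum.Base using (_⊎_; inj₁; inj₂; swap; [_,_]′)
open import Data.Vec.Base using ([]; _∷_; lookup; tabulate)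
import Data.Vec.Properties as Vec
open import Function.Base using (_∘_)
open import Function.Bundles using (_⇔_; mk⇔; Func)
open import Function.Definitions using (Injective)
open import Level using (Level; 0ℓ)
open import Relation.Binary.Core using (Rel; _⇒_)
open import Relation.Binary.Definitions using (Decidable; Symmetric)
open import Relation.Binary.PropositionalEquality as ≡ using (_≡_; _≢_)
open import Relation.Nullary using (¬_; yes; no; does; contradiction)
open import Relation.Nullary.Decidable using (¬?; _×-dec_; _⊎-dec_)

-- Finite sets and permutations

n≤∣p∣⇒x∈p : ∀ {n} {p : Subset n} → n ℕ.≤ ∣ p ∣ → ∀ x → x ∈ p
n≤∣p∣⇒x∈p {p = p} n≤∣p∣ x
  rewrite ∣p∣≡n⇒p≡⊤ {p = p} (ℕ.≤-antisym (∣p∣≤n p) n≤∣p∣) = ∈⊤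

-- Two distinct missing points would put `p` inside `⊤ ∖ x ∖ y`, and each removal lowers the size by
-- at least one.
n≤1+∣p∣⇒∉-unique : ∀ {n} {p : Subset n} → n ℕ.≤ ℕ.suc ∣ p ∣ →
                   ∀ {x y} → x ∉ p → y ∉ p → x ≡ y
n≤1+∣p∣⇒∉-unique {n} {p} n≤1+∣p∣ {x} {y} x∉p y∉p with x Fin.≟ y
... | yes x≡y = x≡y
... | no  x≢y = contradiction n≤1+∣p∣ (ℕ.<⇒≱ (begin
    ℕ.suc (ℕ.suc ∣ p ∣)           ≤⟨ ℕ.s≤s (ℕ.s≤s (p⊆q⇒∣p∣≤∣q∣ p⊆⊤-x-y)) ⟩
    ℕ.suc (ℕ.suc ∣ ⊤ ∖ x ∖ y ∣)   ≤⟨ ℕ.s≤s (x∈p⇒∣p-x∣<∣p∣ (x∈p∧x≢y⇒x∈p-y ∈⊤ (x≢y ∘ ≡.sym))) ⟩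
    ℕ.suc ∣ ⊤ ∖ x ∣               ≤⟨ x∈p⇒∣p-x∣<∣p∣ {x = x} ∈⊤ ⟩
    ∣ ⊤ {n} ∣                     ≡⟨ ∣⊤∣≡n n ⟩
    n                             ∎))
  where
  open ℕ.≤-Reasoning
  p⊆⊤-x-y : p ⊆ ⊤ ∖ x ∖ y
  p⊆⊤-x-y z∈p = x∈p∧x≢y⇒x∈p-y
    (x∈p∧x≢y⇒x∈p-y ∈⊤ λ { ≡.refl → x∉p z∈p }) λ { ≡.refl → y∉p z∈p }

2≤∣p∣⇒distinct : ∀ {n} {p : Subset n} → 2 ℕ.≤ ∣ p ∣ →
                 ∃₂ λ x y → x ∈ p × y ∈ p × x ≢ y
2≤∣p∣⇒distinct {n} {p} 2≤∣p∣ with nonempty? p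
... | no empty = contradiction
  (≡.subst (2 ℕ.≤_) (≡.trans (≡.cong ∣_∣ (Empty-unique empty)) (∣⊥∣≡0 n)) 2≤∣p∣) λ ()
... | yes (x , x∈p) with Fin.any? (λ y → y ∈? p ×-dec ¬? (x Fin.≟ y))
...   | yes (y , y∈p , x≢y) = x , y , x∈p , y∈p , x≢y
...   | no none = contradiction
  (ℕ.≤-trans 2≤∣p∣ (ℕ.≤-trans (p⊆q⇒∣p∣≤∣q∣ p⊆⁅x⁆) (ℕ.≤-reflexive (∣⁅x⁆∣≡1 x))))
  λ { (ℕ.s≤s ()) }
  where
  p⊆⁅x⁆ : p ⊆ ⁅ x ⁆
  p⊆⁅x⁆ {y} y∈p with x Fin.≟ y
  ... | yes ≡.refl = x∈⁅x⁆ x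
  ... | no  x≢y    = contradiction (y , y∈p , x≢y) none

2≤∣⁅x⁆∪⁅y⁆∣ : ∀ {n} {x y : Fin n} → x ≢ y → 2 ℕ.≤ ∣ ⁅ x ⁆ ∪ ⁅ y ⁆ ∣
2≤∣⁅x⁆∪⁅y⁆∣ {x = x} {y} x≢y = ≡.subst (ℕ._< ∣ ⁅ x ⁆ ∪ ⁅ y ⁆ ∣) (∣⁅x⁆∣≡1 x)
  (p⊂q⇒∣p∣<∣q∣ (p⊆p∪q ⁅ y ⁆ , y , q⊆p∪q ⁅ x ⁆ ⁅ y ⁆ (x∈⁅x⁆ y) ,
                x≢y ∘ ≡.sym ∘ x∈⁅y⁆⇒x≡y x))

n≤1+∣∁⁅x⁆∣ : ∀ {n} (x : Fin n) → n ℕ.≤ ℕ.suc ∣ ∁ ⁅ x ⁆ ∣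
n≤1+∣∁⁅x⁆∣ {n} x = begin
  n                        ≤⟨ ℕ.m≤n+m∸n n 1 ⟩
  ℕ.suc (n ℕ.∸ 1)          ≡⟨ ≡.cong (λ k → ℕ.suc (n ℕ.∸ k)) (∣⁅x⁆∣≡1 x) ⟨
  ℕ.suc (n ℕ.∸ ∣ ⁅ x ⁆ ∣)  ≡⟨ ≡.cong ℕ.suc (∣∁p∣≡n∸∣p∣ ⁅ x ⁆) ⟨
  ℕ.suc ∣ ∁ ⁅ x ⁆ ∣        ∎
  where open ℕ.≤-Reasoning

x∈∁⁅y⁆⇒x≢y : ∀ {n} {x y : Fin n} → x ∈ ∁ ⁅ y ⁆ → x ≢ y
x∈∁⁅y⁆⇒x≢y {y = y} x∈∁ ≡.refl = x∈∁p⇒x∉p x∈∁ (x∈⁅x⁆ y)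

preimage : ∀ {m n} → (Fin m → Fin n) → Subset n → Subset m
preimage f p = tabulate (lookup p ∘ f)

∈-preimage⁻ : ∀ {m n} (f : Fin m → Fin n) p {i} → i ∈ preimage f p → f i ∈ p
∈-preimage⁻ f p {i} i∈ = Vec.lookup⇒[]= (f i) p
  (≡.trans (≡.sym (Vec.lookup∘tabulate (lookup p ∘ f) i)) (Vec.[]=⇒lookup i∈))

-- Size is a sum of 0/1 indicators, and a sum over all indices is invariant under permutation.
∣preimage∣ : ∀ {n} (π : Permutation′ n) p → ∣ preimage (π ⟨$⟩ʳ_) p ∣ ≡ ∣ p ∣
∣preimage∣ π p = begin
  ∣ preimage (π ⟨$⟩ʳ_) p ∣
    ≡⟨ size (preimage (π ⟨$⟩ʳ_) p) ⟩
  sum (indicator ∘ lookup (preimage (π ⟨$⟩ʳ_) p))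
    ≡⟨ sum-cong-≗ (λ i → ≡.cong indicator (Vec.lookup∘tabulate (lookup p ∘ (π ⟨$⟩ʳ_)) i)) ⟩
  sum (indicator ∘ lookup p ∘ (π ⟨$⟩ʳ_))
    ≡⟨ sum-permute (indicator ∘ lookup p) π ⟨
  sum (indicator ∘ lookup p)
    ≡⟨ size p ⟨
  ∣ p ∣
    ∎
  where
  open CommutativeMonoidSum ℕ.+-0-commutativeMonoid
  open ≡.≡-Reasoning
  indicator = λ s → if s then 1 else 0
  size : ∀ {n} (q : Subset n) → ∣ q ∣ ≡ sum (indicator ∘ lookup q)
  size []            = ≡.refl
  size (inside  ∷ q) = ≡.cong ℕ.suc (size q)
  size (outside ∷ q) = size q

-- Once `u` is deleted, `v` becomes `punchOut u≢v`; `x′` is another of the remaining vertices, and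
-- `punchIn u` puts it back.
∃-third : ∀ {n} → 3 ℕ.≤ n → {u v : Fin n} → u ≢ v → ∃ λ x → x ≢ u × x ≢ v
∃-third (ℕ.s≤s (ℕ.s≤s (ℕ.s≤s _))) {u} {v} u≢v =
  punchIn u x′ , Fin.punchInᵢ≢i u x′ , λ x≡v →
    Fin.punchInᵢ≢i (punchOut u≢v) 0F
      (Fin.punchIn-injective u x′ _ (≡.trans x≡v (≡.sym (Fin.punchIn-punchOut u≢v))))
  where x′ = punchIn (punchOut u≢v) 0F

-- Pigeonhole: if `j` were missed, deleting it from the codomain would leave an injection into a
-- smaller finite set.
injective⇒hit : ∀ {n} {f : Fin n → Fin n} → Injective _≡_ _≡_ f →
                ∀ j → ∃ λ i → f i ≡ j
injective⇒hit {ℕ.suc n} {f} f-inj j with Fin.any? (λ i → f i Fin.≟ j)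
... | yes hit = hit
... | no miss = contradiction
  (λ {x} {y} eq → f-inj (Fin.punchOut-injective (j≢f x) (j≢f y) eq))
  (Fin.<⇒notInjective {f = λ i → punchOut (j≢f i)} (ℕ.n<1+n n))
  where
  j≢f : ∀ i → j ≢ f i
  j≢f i j≡fi = miss (i , ≡.sym j≡fi)

injective⇒permutation : ∀ {n} {f : Fin n → Fin n} → Injective _≡_ _≡_ f →
                        ∃ λ (π : Permutation′ n) → ∀ i → π ⟨$⟩ʳ i ≡ f i
injective⇒permutation {f = f} f-inj =
  permutation f (proj₁ ∘ hit) (proj₂ ∘ hit) (λ i → f-inj (proj₂ (hit (f i)))) ,
  λ i → ≡.refl
  where hit = injective⇒hit f-inj

permutation-≢ : ∀ {n} (π : Permutation′ n) {i j} → i ≢ j → π ⟨$⟩ʳ i ≢ π ⟨$⟩ʳ j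
permutation-≢ π i≢j eq = i≢j
  (≡.trans (≡.sym (inverseˡ π)) (≡.trans (≡.cong (π ⟨$⟩ˡ_) eq) (inverseˡ π)))

-- Edges and stars

Edge : ∀ {n} → Fin n → Fin n → Rel (Fin n) 0ℓ
Edge u v i j = (i ≡ u × j ≡ v) ⊎ (i ≡ v × j ≡ u)

edge? : ∀ {n} (u v : Fin n) → Decidable (Edge u v)
edge? u v i j =
  (i Fin.≟ u ×-dec j Fin.≟ v) ⊎-dec (i Fin.≟ v ×-dec j Fin.≟ u)

edge-sym : ∀ {n} (u v : Fin n) → Symmetric (Edge u v)
edge-sym u v (inj₁ (i≡u , j≡v)) = inj₂ (j≡v , i≡u)
edge-sym u v (inj₂ (i≡v , j≡u)) = inj₁ (j≡u , i≡v)

nonEdge? : ∀ {n} (u v : Fin n) → Decidable (λ i j → ¬ Edge u v i j)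
nonEdge? u v i j = ¬? (edge? u v i j)

nonEdge-sym : ∀ {n} (u v : Fin n) → Symmetric (λ i j → ¬ Edge u v i j)
nonEdge-sym u v ¬e e = ¬e (edge-sym u v e)

-- The loop at `u` is included; this is harmless, since `star` restricts `J-I`, whose diagonal is
-- zero.
Incident : ∀ {n} → Fin n → Rel (Fin n) 0ℓ
Incident u i j = i ≡ u ⊎ j ≡ u

incident? : ∀ {n} (u : Fin n) → Decidable (Incident u)
incident? u i j = i Fin.≟ u ⊎-dec j Fin.≟ u

edge⇒incidentˡ : ∀ {n} (u v : Fin n) → Edge u v ⇒ Incident u
edge⇒incidentˡ u v (inj₁ (i≡u , _)) = inj₁ i≡u
edge⇒incidentˡ u v (inj₂ (_ , j≡u)) = inj₂ j≡u

edge⇒incidentʳ : ∀ {n} (u v : Fin n) → Edge u v ⇒ Incident v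
edge⇒incidentʳ u v (inj₁ (_ , j≡v)) = inj₂ j≡v
edge⇒incidentʳ u v (inj₂ (i≡v , _)) = inj₁ i≡v

incident-both⇒edge : ∀ {n} {u v i j : Fin n} → u ≢ v →
                     Incident u i j → Incident v i j → Edge u v i j
incident-both⇒edge u≢v (inj₁ i≡u) (inj₁ i≡v) = contradiction (≡.trans (≡.sym i≡u) i≡v) u≢v
incident-both⇒edge u≢v (inj₁ i≡u) (inj₂ j≡v) = inj₁ (i≡u , j≡v)
incident-both⇒edge u≢v (inj₂ j≡u) (inj₁ i≡v) = inj₂ (i≡v , j≡u)
incident-both⇒edge u≢v (inj₂ j≡u) (inj₂ j≡v) = contradiction (≡.trans (≡.sym j≡u) j≡v) u≢v

n≤2⇒edge : ∀ {n} → n ℕ.≤ 2 → {u v i j : Fin n} → u ≢ v → i ≢ j → Edge u v i j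
n≤2⇒edge {1} _ {0F} {0F} u≢v _ = contradiction ≡.refl u≢v
n≤2⇒edge {2} _ {0F} {0F} u≢v _ = contradiction ≡.refl u≢v
n≤2⇒edge {2} _ {1F} {1F} u≢v _ = contradiction ≡.refl u≢v
n≤2⇒edge {2} _ {_} {_} {0F} {0F} _ i≢j = contradiction ≡.refl i≢j
n≤2⇒edge {2} _ {_} {_} {1F} {1F} _ i≢j = contradiction ≡.refl i≢j
n≤2⇒edge {2} _ {0F} {1F} {0F} {1F} _ _ = inj₁ (≡.refl , ≡.refl)
n≤2⇒edge {2} _ {0F} {1F} {1F} {0F} _ _ = inj₂ (≡.refl , ≡.refl)
n≤2⇒edge {2} _ {1F} {0F} {0F} {1F} _ _ = inj₂ (≡.refl , ≡.refl)
n≤2⇒edge {2} _ {1F} {0F} {1F} {0F} _ _ = inj₁ (≡.refl , ≡.refl)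
n≤2⇒edge {ℕ.suc (ℕ.suc (ℕ.suc _))} (ℕ.s≤s (ℕ.s≤s ()))

-- Edges that share a position coincide. Hence deleting `u v` leaves every other edge intact.
edge-disjoint : ∀ {n} {u v x y : Fin n} → ¬ Edge u v x y →
                ∀ {i j} → Edge x y i j → ¬ Edge u v i j
edge-disjoint ¬e (inj₁ (≡.refl , ≡.refl)) e = ¬e e
edge-disjoint {u = u} {v} ¬e (inj₂ (≡.refl , ≡.refl)) e = ¬e (edge-sym u v e)

module _ {c ℓ₁ ℓ₂ : Level} (ℝ : RealNumbers c ℓ₁ ℓ₂) where

  open RealNumbers ℝ hiding (zero)
  open RealMatrices ℝ
  open SemiringSum semiring
  open import Relation.Binary.Reasoning.Setoid setoid

  -- Real numbers

  -- `x` is squeezed between 0 and `x + y`.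
  summand-zeroˡ : ∀ {x y} → 0# ≤ x → 0# ≤ y → x + y ≈ 0# → x ≈ 0#
  summand-zeroˡ {x} 0≤x 0≤y x+y≈0 = antisym
    (≤-respʳ-≈ x+y≈0 (≤-respˡ-≈ (+-identityʳ x) (+-monoʳ-≤ x 0≤y))) 0≤x

  summand-zeroʳ : ∀ {x y} → 0# ≤ x → 0# ≤ y → x + y ≈ 0# → y ≈ 0#
  summand-zeroʳ 0≤x 0≤y x+y≈0 = summand-zeroˡ 0≤y 0≤x (trans (+-comm _ _) x+y≈0)

  x*y≈0⇒y≈0 : ∀ {x y} → ¬ (x ≈ 0#) → x * y ≈ 0# → y ≈ 0#
  x*y≈0⇒y≈0 {x} {y} x≉0 xy≈0 with inverse x x≉0
  ... | x⁻¹ , xx⁻¹≈1 = begin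
    y              ≈⟨ *-identityˡ y ⟨
    1# * y         ≈⟨ *-congʳ xx⁻¹≈1 ⟨
    x * x⁻¹ * y    ≈⟨ *-congʳ (*-comm x x⁻¹) ⟩
    x⁻¹ * x * y    ≈⟨ *-assoc x⁻¹ x y ⟩
    x⁻¹ * (x * y)  ≈⟨ *-congˡ xy≈0 ⟩
    x⁻¹ * 0#       ≈⟨ zeroʳ x⁻¹ ⟩
    0#             ∎

  sum-nonNegative : ∀ {n} (f : Fin n → Carrier) → (∀ i → 0# ≤ f i) → 0# ≤ sum f
  sum-nonNegative {ℕ.zero}  f 0≤f = ≤-refl
  sum-nonNegative {ℕ.suc n} f 0≤f =
    +-nonNegative (0≤f zero) (sum-nonNegative (f ∘ suc) (0≤f ∘ suc))

  sum≈0⇒≈0 : ∀ {n} (f : Fin n → Carrier) → (∀ i → 0# ≤ f i) →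
             sum f ≈ 0# → ∀ i → f i ≈ 0#
  sum≈0⇒≈0 f 0≤f ∑f≈0 zero =
    summand-zeroˡ (0≤f zero) (sum-nonNegative (f ∘ suc) (0≤f ∘ suc)) ∑f≈0
  sum≈0⇒≈0 f 0≤f ∑f≈0 (suc i) = sum≈0⇒≈0 (f ∘ suc) (0≤f ∘ suc)
    (summand-zeroʳ (0≤f zero) (sum-nonNegative (f ∘ suc) (0≤f ∘ suc)) ∑f≈0) i

  ≉0⇒>0 : ∀ {x} → 0# ≤ x → ¬ (x ≈ 0#) → 0# < x
  ≉0⇒>0 0≤x x≉0 = 0≤x , x≉0 ∘ sym

  δ-≢ : ∀ {n} {i j : Fin n} → i ≢ j → δ i j ≈ 0#
  δ-≢ {i = i} {j} i≢j with i Fin.≟ j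
  ... | yes i≡j = contradiction i≡j i≢j
  ... | no  _   = refl

  δ-≡ : ∀ {n} {i j : Fin n} → i ≡ j → δ i j ≈ 1#
  δ-≡ {i = i} {j} i≡j with i Fin.≟ j
  ... | yes _   = refl
  ... | no  i≢j = contradiction i≡j i≢j

  sum-single : ∀ {n} (f : Fin n → Carrier) i →
               (∀ j → j ≢ i → f j ≈ 0#) → sum f ≈ f i
  sum-single {ℕ.suc n} f i f≈0 = begin
    sum f                          ≈⟨ sum-remove {i = i} f ⟩
    f i + sum (f ∘ punchIn i)      ≈⟨ +-congˡ (sum-cong-≋ λ j → f≈0 (punchIn i j) (Fin.punchInᵢ≢i i j)) ⟩
    f i + sum {n} (λ _ → 0#)       ≈⟨ +-congˡ (sum-replicate-zero n) ⟩
    f i + 0#                       ≈⟨ +-identityʳ (f i) ⟩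
    f i                            ∎

  -- Column `k` of `P` has its only nonzero entry in row `σ ⟨$⟩ˡ k`, so each of the two sums reduces
  -- to one term.
  permutation-conjugate : ∀ {n} (P X : Matrix n n) (σ : Permutation′ n) →
    (∀ i j → P i j ≈ δ (σ ⟨$⟩ʳ i) j) →
    P ᵀ *ₘ X *ₘ P ≈ₘ λ i j → X (σ ⟨$⟩ˡ i) (σ ⟨$⟩ˡ j)
  permutation-conjugate P X σ P≈δ i j = begin
    sum (λ l → (P ᵀ *ₘ X) i l * P l j)
      ≈⟨ sum-single _ j′ (λ l l≢j′ → trans (*-congˡ (P-off l≢j′)) (zeroʳ _)) ⟩
    (P ᵀ *ₘ X) i j′ * P j′ j
      ≈⟨ *-congˡ P-on ⟩
    (P ᵀ *ₘ X) i j′ * 1#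
      ≈⟨ *-identityʳ _ ⟩
    sum (λ k → P k i * X k j′)
      ≈⟨ sum-single _ i′ (λ k k≢i′ → trans (*-congʳ (P-off k≢i′)) (zeroˡ _)) ⟩
    P i′ i * X i′ j′
      ≈⟨ *-congʳ P-on ⟩
    1# * X i′ j′
      ≈⟨ *-identityˡ _ ⟩
    X i′ j′
      ∎
    where
    i′ = σ ⟨$⟩ˡ i
    j′ = σ ⟨$⟩ˡ j
    P-on : ∀ {k} → P (σ ⟨$⟩ˡ k) k ≈ 1#
    P-on {k} = trans (P≈δ _ k) (δ-≡ (inverseʳ σ))
    P-off : ∀ {l k} → l ≢ σ ⟨$⟩ˡ k → P l k ≈ 0#
    P-off {l} {k} l≢ = trans (P≈δ l k)
      (δ-≢ λ σl≡k → l≢ (≡.trans (≡.sym (inverseˡ σ)) (≡.cong (σ ⟨$⟩ˡ_) σl≡k)))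

  -- Independence numbers

  α-mono : ∀ {m n} {A : Matrix m m} {B : Matrix n n} →
           (∀ S → IsZeroPrincipal A S → ∃ λ T → IsZeroPrincipal B T × ∣ S ∣ ℕ.≤ ∣ T ∣) →
           α A ℕ.≤ α B
  α-mono {A = A} {B} lift
    with independenceNumber A | independenceNumber B
  ... | _ , (S , zeroS , ≡.refl) , _ | _ , _ , bound with lift S zeroS
  ...   | T , zeroT , ∣S∣≤∣T∣ = ℕ.≤-trans ∣S∣≤∣T∣ (bound T zeroT)

  -- `T` is a largest zero set of `B`, whatever `S` is: equal independence numbers carry over sizes,
  -- not the sets themselves.
  α-lift : ∀ {m n} (A : Matrix m m) (B : Matrix n n) → α A ≡ α B →
           ∀ {S} → IsZeroPrincipal A S → ∃ λ T → IsZeroPrincipal B T × ∣ S ∣ ℕ.≤ ∣ T ∣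
  α-lift A B αA≡αB {S} zeroS
    with independenceNumber A | independenceNumber B
  ... | _ , _ , bound | _ , (T , zeroT , ∣T∣≡αB) , _ =
    T , zeroT , ℕ.≤-trans (bound S zeroS) (ℕ.≤-reflexive (≡.trans αA≡αB (≡.sym ∣T∣≡αB)))

  -- Matrices in S⁺

  diagonal-zero : ∀ {n} (X : S⁺ n) i → matrix X i i ≈ 0#
  diagonal-zero X =
    sum≈0⇒≈0 (λ i → matrix X i i) (λ i → nonNegative X i i) (zeroTrace X)

  J-I-off : ∀ {n} {i j : Fin n} → i ≢ j → matrix (J-I n) i j ≈ 1#
  J-I-off {i = i} {j} i≢j = begin
    1# - δ i j  ≈⟨ +-congˡ (-‿cong (δ-≢ i≢j)) ⟩
    1# - 0#     ≈⟨ +-congˡ (trans (sym (+-identityˡ _)) (-‿inverseʳ 0#)) ⟩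
    1# + 0#     ≈⟨ +-identityʳ 1# ⟩
    1#          ∎

  module _ {n : ℕ} {R : Rel (Fin n) 0ℓ} (R? : Decidable R) (R-sym : Symmetric R) (X : S⁺ n) where

    -- Edges, stars and edge deletion are all instances of this construction.
    restrictMatrix : Matrix n n
    restrictMatrix i j = if does (R? i j) then matrix X i j else 0#

    restrict-on : ∀ {i j} → R i j → restrictMatrix i j ≈ matrix X i j
    restrict-on {i} {j} Rij with R? i j
    ... | yes _   = refl
    ... | no ¬Rij = contradiction Rij ¬Rij

    restrict-off : ∀ {i j} → ¬ R i j → restrictMatrix i j ≈ 0#
    restrict-off {i} {j} ¬Rij with R? i j
    ... | yes Rij = contradiction Rij ¬Rij
    ... | no  _   = refl

    restrict : S⁺ n
    restrict = record
      { matrix      = restrictMatrix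
      ; nonNegative = nonNeg
      ; symmetric   = symm
      ; zeroTrace   = trans (sum-cong-≋ {n} diag) (sum-replicate-zero n)
      }
      where
      nonNeg : ∀ i j → 0# ≤ restrictMatrix i j
      nonNeg i j with R? i j
      ... | yes _ = nonNegative X i j
      ... | no  _ = ≤-refl
      symm : restrictMatrix ≈ₘ restrictMatrix ᵀ
      symm i j with R? i j
      ... | yes Rij = trans (symmetric X i j) (sym (restrict-on (R-sym Rij)))
      ... | no ¬Rij = sym (restrict-off (¬Rij ∘ R-sym))
      diag : ∀ i → restrictMatrix i i ≈ 0#
      diag i with R? i i
      ... | yes _ = diagonal-zero X i
      ... | no  _ = refl

  -- Edge matrices, star matrices and deletion of an edge

  edge : ∀ {n} → Fin n → Fin n → S⁺ n
  edge u v = restrict (edge? u v) (edge-sym u v) (J-I _)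

  star : ∀ {n} → Fin n → S⁺ n
  star u = restrict (incident? u) swap (J-I _)

  delete : ∀ {n} → Fin n → Fin n → S⁺ n → S⁺ n
  delete u v = restrict (nonEdge? u v) (nonEdge-sym u v)

  edge-on : ∀ {n} {u v : Fin n} → u ≢ v → matrix (edge u v) u v ≈ 1#
  edge-on {u = u} {v} u≢v =
    trans (restrict-on (edge? u v) (edge-sym u v) (J-I _) (inj₁ (≡.refl , ≡.refl)))
          (J-I-off u≢v)

  star-on : ∀ {n} {u i j : Fin n} → Incident u i j → i ≢ j → matrix (star u) i j ≈ 1#
  star-on {u = u} inc i≢j =
    trans (restrict-on (incident? u) swap (J-I _) inc) (J-I-off i≢j)

  delete-off : ∀ {n} (u v : Fin n) X → matrix (delete u v X) u v ≈ 0#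
  delete-off u v X = restrict-off (nonEdge? u v) (nonEdge-sym u v) X λ ¬e → ¬e (inj₁ (≡.refl , ≡.refl))

  pair-zero : ∀ {n} {u v : Fin n} (X : S⁺ n) → matrix X u v ≈ 0# →
              IsZeroPrincipal (matrix X) (⁅ u ⁆ ∪ ⁅ v ⁆)
  pair-zero {u = u} {v} X Xuv≈0 i j i∈ j∈
    with [ inj₁ ∘ x∈⁅y⁆⇒x≡y u , inj₂ ∘ x∈⁅y⁆⇒x≡y v ]′ (x∈p∪q⁻ ⁅ u ⁆ ⁅ v ⁆ i∈)
       | [ inj₁ ∘ x∈⁅y⁆⇒x≡y u , inj₂ ∘ x∈⁅y⁆⇒x≡y v ]′ (x∈p∪q⁻ ⁅ u ⁆ ⁅ v ⁆ j∈)
  ... | inj₁ ≡.refl | inj₁ ≡.refl = diagonal-zero X u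
  ... | inj₁ ≡.refl | inj₂ ≡.refl = Xuv≈0
  ... | inj₂ ≡.refl | inj₁ ≡.refl = trans (symmetric X v u) Xuv≈0
  ... | inj₂ ≡.refl | inj₂ ≡.refl = diagonal-zero X v

  edge-split : ∀ {n} {u v : Fin n} → u ≢ v → (X : S⁺ n) →
    matrix X ≈ₘ matrix X u v ·ₘ matrix (edge u v) +ₘ matrix (delete u v X)
  edge-split {n} {u} {v} u≢v X i j with edge? u v i j
  ... | yes e = begin
    matrix X i j
      ≈⟨ X-uv e ⟨
    matrix X u v
      ≈⟨ *-identityʳ _ ⟨
    matrix X u v * 1#
      ≈⟨ *-congˡ (trans (restrict-on (edge? u v) (edge-sym u v) (J-I n) e) (J-I-off (i≢j e))) ⟨
    matrix X u v * matrix (edge u v) i j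
      ≈⟨ +-identityʳ _ ⟨
    matrix X u v * matrix (edge u v) i j + 0#
      ≈⟨ +-congˡ (restrict-off (nonEdge? u v) (nonEdge-sym u v) X (λ ¬e → ¬e e)) ⟨
    matrix X u v * matrix (edge u v) i j + matrix (delete u v X) i j
      ∎
    where
    i≢j : Edge u v i j → i ≢ j
    i≢j (inj₁ (≡.refl , ≡.refl)) = u≢v
    i≢j (inj₂ (≡.refl , ≡.refl)) = u≢v ∘ ≡.sym
    X-uv : Edge u v i j → matrix X u v ≈ matrix X i j
    X-uv (inj₁ (≡.refl , ≡.refl)) = refl
    X-uv (inj₂ (≡.refl , ≡.refl)) = symmetric X u v
  ... | no ¬e = begin
    matrix X i j
      ≈⟨ +-identityˡ _ ⟨
    0# + matrix X i j
      ≈⟨ +-congʳ (zeroʳ _) ⟨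
    matrix X u v * 0# + matrix X i j
      ≈⟨ +-cong (*-congˡ (restrict-off (edge? u v) (edge-sym u v) (J-I n) ¬e))
                (restrict-on (nonEdge? u v) (nonEdge-sym u v) X ¬e) ⟨
    matrix X u v * matrix (edge u v) i j + matrix (delete u v X) i j
      ∎

  -- Linear maps on S⁺

  module _ {n : ℕ} (φ : S⁺-Map n) (linear : IsLinear φ) where

    φ-diagonal : ∀ X i → (φ ⟦ X ⟧) i i ≈ 0#
    φ-diagonal X = diagonal-zero (Func.to φ X)

    φ-0≤ : ∀ X i j → 0# ≤ (φ ⟦ X ⟧) i j
    φ-0≤ X = nonNegative (Func.to φ X)

    φ-sym : ∀ X i j → (φ ⟦ X ⟧) i j ≈ (φ ⟦ X ⟧) j i
    φ-sym X = symmetric (Func.to φ X)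

    -- `linear` speaks of `conic` combinations only; `Func.cong` carries it over to any `Z` with the
    -- same entries, the second coefficient being 1.
    φ-split : ∀ {a} → 0# ≤ a → ∀ X Y Z → matrix Z ≈ₘ a ·ₘ matrix X +ₘ matrix Y →
              φ ⟦ Z ⟧ ≈ₘ a ·ₘ φ ⟦ X ⟧ +ₘ φ ⟦ Y ⟧
    φ-split 0≤a X Y Z Z≈ i j =
      trans (Func.cong φ {Z} {conic 0≤a 0≤1 X Y}
               (λ k l → trans (Z≈ k l) (+-congˡ (sym (*-identityˡ _)))) i j)
        (trans (linear X Y 0≤a 0≤1 i j) (+-congˡ (*-identityˡ _)))

    φ-+ : ∀ X Y Z → matrix Z ≈ₘ matrix X +ₘ matrix Y → φ ⟦ Z ⟧ ≈ₘ φ ⟦ X ⟧ +ₘ φ ⟦ Y ⟧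
    φ-+ X Y Z Z≈ i j =
      trans (φ-split 0≤1 X Y Z (λ k l → trans (Z≈ k l) (+-congʳ (sym (*-identityˡ _)))) i j)
        (+-congʳ (*-identityˡ _))

    -- The image of the larger restriction is the image of the smaller one plus that of a remainder.
    -- All entries are nonnegative, so a zero of the sum is a zero of each summand.
    restrict-mono : ∀ {R Q : Rel (Fin n) 0ℓ}
      (R? : Decidable R) (R-sym : Symmetric R) (Q? : Decidable Q) (Q-sym : Symmetric Q) →
      R ⇒ Q → ∀ X {k l} →
      (φ ⟦ restrict Q? Q-sym X ⟧) k l ≈ 0# → (φ ⟦ restrict R? R-sym X ⟧) k l ≈ 0#
    restrict-mono {R} R? R-sym Q? Q-sym R⇒Q X {k} {l} φQ≈0 =
      summand-zeroˡ (φ-0≤ XR k l) (φ-0≤ rest k l)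
        (trans (sym (φ-+ XR rest XQ split k l)) φQ≈0)
      where
      XQ = restrict Q? Q-sym X
      XR = restrict R? R-sym X
      ¬R-sym : Symmetric λ i j → ¬ R i j
      ¬R-sym ¬Rij Rji = ¬Rij (R-sym Rji)
      rest = restrict (λ i j → ¬? (R? i j)) ¬R-sym XQ
      split : matrix XQ ≈ₘ matrix XR +ₘ matrix rest
      split i j with R? i j
      ... | yes Rij = trans (restrict-on Q? Q-sym X (R⇒Q Rij)) (sym (+-identityʳ _))
      ... | no  _   = sym (+-identityˡ _)

    -- Linear maps that preserve the independence number

    module _ (preserves : ∀ X → α (φ ⟦ X ⟧) ≡ α (matrix X)) where

      push : ∀ X {S} → IsZeroPrincipal (matrix X) S →
             ∃ λ T → IsZeroPrincipal (φ ⟦ X ⟧) T × ∣ S ∣ ℕ.≤ ∣ T ∣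
      push X = α-lift (matrix X) (φ ⟦ X ⟧) (≡.sym (preserves X))

      pull : ∀ X {T} → IsZeroPrincipal (φ ⟦ X ⟧) T →
             ∃ λ S → IsZeroPrincipal (matrix X) S × ∣ T ∣ ℕ.≤ ∣ S ∣
      pull X = α-lift (φ ⟦ X ⟧) (matrix X) (preserves X)

      abstract
        -- The vertices other than `u` are independent in the star, so the image has an independent
        -- set `T` that misses at most one vertex; a missed vertex is the centre.
        star-centre : ∀ u → ∃ λ w → ∀ k l → ¬ Incident w k l → (φ ⟦ star u ⟧) k l ≈ 0#
        star-centre u with push (star u) {∁ ⁅ u ⁆} (λ i j i∈ j∈ →
          restrict-off (incident? u) swap (J-I n)
            [ x∈∁⁅y⁆⇒x≢y i∈ , x∈∁⁅y⁆⇒x≢y j∈ ]′)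
        ... | T , zeroT , ∣∁⁅u⁆∣≤∣T∣ with Fin.any? (λ w → ¬? (w ∈? T))
        -- Here `T` is everything, so the whole image vanishes and any vertex can serve as centre.
        ...   | no all = u , λ k l _ → zeroT k l (in-T k) (in-T l)
          where
          in-T : ∀ x → x ∈ T
          in-T x with x ∈? T
          ... | yes x∈T = x∈T
          ... | no  x∉T = contradiction (x , x∉T) all
        ...   | yes (w , w∉T) = w , λ k l ¬inc →
          zeroT k l (in-T (¬inc ∘ inj₁)) (in-T (¬inc ∘ inj₂))
          where
          in-T : ∀ {x} → x ≢ w → x ∈ T
          in-T {x} x≢w with x ∈? T
          ... | yes x∈T = x∈T
          ... | no  x∉T = contradiction
            (n≤1+∣p∣⇒∉-unique (ℕ.≤-trans (n≤1+∣∁⁅x⁆∣ u) (ℕ.s≤s ∣∁⁅u⁆∣≤∣T∣)) x∉T w∉T) x≢w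

      centre : Fin n → Fin n
      centre u = proj₁ (star-centre u)

      -- With a common centre both star images vanish off that vertex, so `pull` yields a zero set
      -- `S` of `D` that misses at most one vertex. But `u`, `v` and a third vertex `x` form a
      -- triangle in `D`, so `S` contains at most one of them.
      centre-injective : 3 ℕ.≤ n → Injective _≡_ _≡_ centre
      centre-injective 3≤n {u} {v} cu≡cv with u Fin.≟ v
      ... | yes u≡v = u≡v
      ... | no  u≢v with ∃-third 3≤n u≢v
                       | pull D {∁ ⁅ centre u ⁆} φD-zero
        where
        D : S⁺ n
        D = conic 0≤1 0≤1 (star u) (star v)
        φD-zero : IsZeroPrincipal (φ ⟦ D ⟧) (∁ ⁅ centre u ⁆)
        φD-zero i j i∈ j∈ = begin
          (φ ⟦ D ⟧) i j
            ≈⟨ linear (star u) (star v) 0≤1 0≤1 i j ⟩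
          1# * (φ ⟦ star u ⟧) i j + 1# * (φ ⟦ star v ⟧) i j
            ≈⟨ +-cong (*-congˡ (proj₂ (star-centre u) i j ¬inc))
                      (*-congˡ (proj₂ (star-centre v) i j
                        (≡.subst (λ w → ¬ Incident w i j) cu≡cv ¬inc))) ⟩
          1# * 0# + 1# * 0#
            ≈⟨ +-cong (zeroʳ 1#) (zeroʳ 1#) ⟩
          0# + 0#
            ≈⟨ +-identityʳ 0# ⟩
          0#
            ∎
          where
          ¬inc : ¬ Incident (centre u) i j
          ¬inc = [ x∈∁⁅y⁆⇒x≢y i∈ , x∈∁⁅y⁆⇒x≢y j∈ ]′
      ...   | x , x≢u , x≢v | S , zeroS , size = triangle
        where
        -- At an edge of one of the stars a summand of `D` is 1, whereas a vanishing sum of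
        -- nonnegative terms would make it 0.
        sum-of-stars : ∀ {i j} → i ∈ S → j ∈ S → i ≢ j → ¬ (Incident u i j ⊎ Incident v i j)
        sum-of-stars {i} {j} i∈S j∈S i≢j inc =
          [ (λ inc-u → 0≉1 (trans (sym (summand-zeroˡ (0≤ u) (0≤ v) D≈0))
                               (trans (*-identityˡ _) (star-on inc-u i≢j))))
          , (λ inc-v → 0≉1 (trans (sym (summand-zeroʳ (0≤ u) (0≤ v) D≈0))
                               (trans (*-identityˡ _) (star-on inc-v i≢j)))) ]′ inc
          where
          0≤ : ∀ w → 0# ≤ 1# * matrix (star w) i j
          0≤ w = *-nonNegative 0≤1 (nonNegative (star w) i j)
          D≈0 = zeroS i j i∈S j∈S
        same : ∀ {y z} → y ∉ S → z ∉ S → y ≡ z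
        same = n≤1+∣p∣⇒∉-unique (ℕ.≤-trans (n≤1+∣∁⁅x⁆∣ (centre u)) (ℕ.s≤s size))
        triangle : u ≡ v
        -- If both are missing they coincide, which is the goal; both present contradicts their
        -- edge. If just one is present, `x` is adjacent to it, hence missing, hence equal to the
        -- other.
        triangle with u ∈? S | v ∈? S
        ... | no u∉S  | no v∉S  = same u∉S v∉S
        ... | yes u∈S | yes v∈S =
          contradiction (inj₁ (inj₁ ≡.refl)) (sum-of-stars u∈S v∈S u≢v)
        ... | yes u∈S | no v∉S  = contradiction
          (same (λ x∈S → sum-of-stars x∈S u∈S x≢u (inj₁ (inj₂ ≡.refl))) v∉S) x≢v
        ... | no u∉S  | yes v∈S = contradiction
          (same (λ x∈S → sum-of-stars x∈S v∈S x≢v (inj₂ (inj₂ ≡.refl))) u∉S) x≢u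

      -- For `n` at least 3, a position off the edge between the two centres avoids one of them.
      -- There the image of that star vanishes and, by `restrict-mono`, so does the image of the
      -- edge.
      edge-support : ∃ λ (σ : Permutation′ n) → ∀ {u v k l} → u ≢ v →
        ¬ Edge (σ ⟨$⟩ʳ u) (σ ⟨$⟩ʳ v) k l → (φ ⟦ edge u v ⟧) k l ≈ 0#
      edge-support with n ℕ.≤? 2
      -- There is at most one edge, so the only positions off it are diagonal.
      ... | yes n≤2 = Perm.id , off
        where
        off : ∀ {u v k l} → u ≢ v → ¬ Edge u v k l → (φ ⟦ edge u v ⟧) k l ≈ 0#
        off {u} {v} {k} {l} u≢v ¬e with k Fin.≟ l
        ... | yes ≡.refl = φ-diagonal (edge u v) k
        ... | no  k≢l    = contradiction (n≤2⇒edge n≤2 u≢v k≢l) ¬e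
      ... | no n≰2 = proj₁ perm , off
        where
        centre-inj = centre-injective (ℕ.≰⇒> n≰2)
        perm = injective⇒permutation centre-inj
        off : ∀ {u v k l} → u ≢ v →
              ¬ Edge (proj₁ perm ⟨$⟩ʳ u) (proj₁ perm ⟨$⟩ʳ v) k l → (φ ⟦ edge u v ⟧) k l ≈ 0#
        off {u} {v} {k} {l} u≢v ¬e
          with incident? (centre u) k l | incident? (centre v) k l
        ... | no ¬inc-u | _ =
          restrict-mono (edge? u v) (edge-sym u v) (incident? u) swap
            (edge⇒incidentˡ u v) (J-I n) (proj₂ (star-centre u) k l ¬inc-u)
        ... | _ | no ¬inc-v =
          restrict-mono (edge? u v) (edge-sym u v) (incident? v) swap
            (edge⇒incidentʳ u v) (J-I n) (proj₂ (star-centre v) k l ¬inc-v)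
        ... | yes inc-u | yes inc-v = contradiction
          (incident-both⇒edge (u≢v ∘ centre-inj) inc-u inc-v) ¬e

      -- Entries of the image at the permuted positions

      σ : Permutation′ n
      σ = proj₁ edge-support

      -- By `edge-support` a zero here would make the whole image zero, with independence number
      -- `n`; yet `edge u v` has an entry 1.
      φ-edge≉0 : ∀ {u v} → u ≢ v → ¬ ((φ ⟦ edge u v ⟧) (σ ⟨$⟩ʳ u) (σ ⟨$⟩ʳ v) ≈ 0#)
      φ-edge≉0 {u} {v} u≢v φE≈0 with pull (edge u v) {⊤} (λ k l _ _ → φE-zero k l)
        where
        φE-zero : ∀ k l → (φ ⟦ edge u v ⟧) k l ≈ 0#
        φE-zero k l with edge? (σ ⟨$⟩ʳ u) (σ ⟨$⟩ʳ v) k l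
        ... | yes (inj₁ (≡.refl , ≡.refl)) = φE≈0
        ... | yes (inj₂ (≡.refl , ≡.refl)) = trans (φ-sym (edge u v) _ _) φE≈0
        ... | no ¬e = proj₂ edge-support u≢v ¬e
      ... | S , zeroS , ∣⊤∣≤∣S∣ =
        0≉1 (trans (sym (zeroS u v (in-S u) (in-S v))) (edge-on u≢v))
        where
        in-S : ∀ x → x ∈ S
        in-S = n≤∣p∣⇒x∈p (≡.subst (ℕ._≤ ∣ S ∣) (∣⊤∣≡n n) ∣⊤∣≤∣S∣)

      σ⁻¹-≢ : ∀ {i j} → i ≢ j → σ ⟨$⟩ˡ i ≢ σ ⟨$⟩ˡ j
      σ⁻¹-≢ = permutation-≢ (Perm.flip σ)

      -- `φ Z` is the sum of the nonnegative `φ X` and `φ Y`, so its zeros are zeros of `φ X`. The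
      -- summand `Y` is there to exclude zeros at every other pair of distinct vertices.
      φ-vanishes : ∀ {u v} → u ≢ v → ∀ X → matrix X u v ≈ 0# →
                   (φ ⟦ X ⟧) (σ ⟨$⟩ʳ u) (σ ⟨$⟩ʳ v) ≈ 0#
      φ-vanishes {u} {v} u≢v X Xuv≈0 =
        from-pair (push Z {⁅ u ⁆ ∪ ⁅ v ⁆} (pair-zero Z Zuv≈0))
        where
        Y Z : S⁺ n
        Y = delete u v (J-I n)
        Z = conic 0≤1 0≤1 X Y
        Zuv≈0 : matrix Z u v ≈ 0#
        Zuv≈0 = trans (+-cong (trans (*-identityˡ _) Xuv≈0)
                        (trans (*-identityˡ _) (delete-off u v (J-I n)))) (+-identityʳ 0#)
        φZ : φ ⟦ Z ⟧ ≈ₘ φ ⟦ X ⟧ +ₘ φ ⟦ Y ⟧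
        φZ = φ-+ X Y Z λ i j → +-cong (*-identityˡ _) (*-identityˡ _)
        from-zero : ∀ {x y} → x ≢ y → (φ ⟦ Z ⟧) (σ ⟨$⟩ʳ x) (σ ⟨$⟩ʳ y) ≈ 0# →
                    (φ ⟦ X ⟧) (σ ⟨$⟩ʳ u) (σ ⟨$⟩ʳ v) ≈ 0#
        from-zero {x} {y} x≢y φZ≈0 with edge? u v x y
        ... | yes (inj₁ (≡.refl , ≡.refl)) =
          summand-zeroˡ (φ-0≤ X _ _) (φ-0≤ Y _ _) (trans (sym (φZ _ _)) φZ≈0)
        ... | yes (inj₂ (≡.refl , ≡.refl)) = trans (φ-sym X _ _)
          (summand-zeroˡ (φ-0≤ X _ _) (φ-0≤ Y _ _) (trans (sym (φZ _ _)) φZ≈0))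
        -- A zero at another pair would be a zero of `φ Y`; since `Y` contains the edge `x y`, the
        -- image of that edge would vanish there as well.
        ... | no ¬e = contradiction
          (restrict-mono (edge? x y) (edge-sym x y)
            (nonEdge? u v) (nonEdge-sym u v)
            (edge-disjoint ¬e) (J-I n)
            (summand-zeroʳ (φ-0≤ X _ _) (φ-0≤ Y _ _) (trans (sym (φZ _ _)) φZ≈0)))
          (φ-edge≉0 x≢y)
        from-pair : (∃ λ T → IsZeroPrincipal (φ ⟦ Z ⟧) T × ∣ ⁅ u ⁆ ∪ ⁅ v ⁆ ∣ ℕ.≤ ∣ T ∣) →
                    (φ ⟦ X ⟧) (σ ⟨$⟩ʳ u) (σ ⟨$⟩ʳ v) ≈ 0#
        from-pair (T , zeroT , size)
          with 2≤∣p∣⇒distinct (ℕ.≤-trans (2≤∣⁅x⁆∪⁅y⁆∣ u≢v) size)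
        -- The vertices found are written as images under `σ` of distinct vertices.
        ... | k , l , k∈T , l∈T , k≢l = from-zero (σ⁻¹-≢ k≢l)
          (≡.subst₂ (λ i j → (φ ⟦ Z ⟧) i j ≈ 0#) (≡.sym (inverseʳ σ)) (≡.sym (inverseʳ σ))
            (zeroT k l k∈T l∈T))

      φ-entry : ∀ {u v} → u ≢ v → ∀ X →
        (φ ⟦ X ⟧) (σ ⟨$⟩ʳ u) (σ ⟨$⟩ʳ v) ≈
        matrix X u v * (φ ⟦ edge u v ⟧) (σ ⟨$⟩ʳ u) (σ ⟨$⟩ʳ v)
      φ-entry {u} {v} u≢v X = begin
        (φ ⟦ X ⟧) k l
          ≈⟨ φ-split (nonNegative X u v) (edge u v) (delete u v X) X (edge-split u≢v X) k l ⟩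
        matrix X u v * (φ ⟦ edge u v ⟧) k l + (φ ⟦ delete u v X ⟧) k l
          ≈⟨ +-congˡ (φ-vanishes u≢v (delete u v X) (delete-off u v X)) ⟩
        matrix X u v * (φ ⟦ edge u v ⟧) k l + 0#
          ≈⟨ +-identityʳ _ ⟩
        matrix X u v * (φ ⟦ edge u v ⟧) k l
          ∎
        where
        k = σ ⟨$⟩ʳ u
        l = σ ⟨$⟩ʳ v

      -- This identifies the factor in `φ-entry` with an entry of `φ ⟦ J-I n ⟧`, as the coefficient
      -- there is 1.
      φ-entry-J-I : ∀ {u v} → u ≢ v →
        (φ ⟦ J-I n ⟧) (σ ⟨$⟩ʳ u) (σ ⟨$⟩ʳ v) ≈ (φ ⟦ edge u v ⟧) (σ ⟨$⟩ʳ u) (σ ⟨$⟩ʳ v)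
      φ-entry-J-I u≢v = trans (φ-entry u≢v (J-I n))
        (trans (*-congʳ (J-I-off u≢v)) (*-identityˡ _))

      φ-J-I-positive : ∀ i j → i ≢ j → 0# < (φ ⟦ J-I n ⟧) i j
      φ-J-I-positive i j i≢j = ≉0⇒>0 (φ-0≤ (J-I n) i j) λ H≈0 →
        φ-edge≉0 (σ⁻¹-≢ i≢j) (trans (sym (φ-entry-J-I (σ⁻¹-≢ i≢j)))
          (≡.subst₂ (λ k l → (φ ⟦ J-I n ⟧) k l ≈ 0#) (≡.sym (inverseʳ σ)) (≡.sym (inverseʳ σ)) H≈0))

      -- Off the diagonal this is `φ-entry` at the preimages of `i` and `j` under `σ`; on the
      -- diagonal both sides vanish.
      φ-conjugate : ∀ X i j →
        (φ ⟦ X ⟧) i j ≈ (φ ⟦ J-I n ⟧) i j * matrix X (σ ⟨$⟩ˡ i) (σ ⟨$⟩ˡ j)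
      φ-conjugate X i j with i Fin.≟ j
      ... | yes ≡.refl = trans (φ-diagonal X i)
        (sym (trans (*-congʳ (φ-diagonal (J-I n) i)) (zeroˡ _)))
      ... | no i≢j = ≡.subst₂
        (λ k l → (φ ⟦ X ⟧) k l ≈ (φ ⟦ J-I n ⟧) k l * matrix X (σ ⟨$⟩ˡ i) (σ ⟨$⟩ˡ j))
        (inverseʳ σ) (inverseʳ σ)
        (trans (φ-entry (σ⁻¹-≢ i≢j) X)
          (trans (*-comm _ _) (*-congʳ (sym (φ-entry-J-I (σ⁻¹-≢ i≢j))))))

    -- As the off-diagonal entries of `φ ⟦ J-I n ⟧` are nonzero, the zeros of `φ X` and of `X`
    -- correspond under `π`. So zero sets can be moved both ways by preimages, which keep their
    -- size.
    conjugate⇒preserves : (∀ i j → i ≢ j → 0# < (φ ⟦ J-I n ⟧) i j) →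
      (π : Permutation′ n) →
      (∀ X i j → (φ ⟦ X ⟧) i j ≈ (φ ⟦ J-I n ⟧) i j * matrix X (π ⟨$⟩ˡ i) (π ⟨$⟩ˡ j)) →
      ∀ X → α (φ ⟦ X ⟧) ≡ α (matrix X)
    conjugate⇒preserves H>0 π φ≈ X = ℕ.≤-antisym
      (α-mono λ S zeroS → preimage (π ⟨$⟩ʳ_) S ,
        (λ i j i∈ j∈ → X-zero i j
          (zeroS _ _ (∈-preimage⁻ (π ⟨$⟩ʳ_) S i∈) (∈-preimage⁻ (π ⟨$⟩ʳ_) S j∈))) ,
        ℕ.≤-reflexive (≡.sym (∣preimage∣ π S)))
      (α-mono λ S zeroS → preimage (π ⟨$⟩ˡ_) S ,
        (λ i j i∈ j∈ → trans (φ≈ X i j) (trans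
          (*-congˡ (zeroS _ _ (∈-preimage⁻ (π ⟨$⟩ˡ_) S i∈) (∈-preimage⁻ (π ⟨$⟩ˡ_) S j∈)))
          (zeroʳ _))) ,
        ℕ.≤-reflexive (≡.sym (∣preimage∣ (Perm.flip π) S)))
      where
      X-zero : ∀ i j → (φ ⟦ X ⟧) (π ⟨$⟩ʳ i) (π ⟨$⟩ʳ j) ≈ 0# → matrix X i j ≈ 0#
      X-zero i j φX≈0 with i Fin.≟ j
      ... | yes ≡.refl = diagonal-zero X i
      ... | no  i≢j = ≡.subst₂ (λ k l → matrix X k l ≈ 0#) (inverseˡ π) (inverseˡ π)
        (x*y≈0⇒y≈0 (proj₂ (H>0 _ _ (permutation-≢ π i≢j)) ∘ sym) (trans (sym (φ≈ X _ _)) φX≈0))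

theorem1 : ∀ {c ℓ₁ ℓ₂} (ℝ : RealNumbers c ℓ₁ ℓ₂) →
    let open RealNumbers ℝ in
    let open RealMatrices ℝ in
    ∀ (n : ℕ) .{{_ : NonZero n}} (φ : S⁺-Map n) → IsLinear φ →
    let H = φ ⟦ J-I n ⟧ in
    (∀ X → α (φ ⟦ X ⟧) ≡ α (matrix X))
      ⇔
    ((∀ i j → i ≢ j → 0# < H i j) ×
     (∃ λ (P : Matrix n n) → IsPermutationMatrix P ×
       (∀ X → φ ⟦ X ⟧ ≈ₘ H ∘ₘ (P ᵀ *ₘ matrix X *ₘ P))))
theorem1 ℝ n φ linear = mk⇔ forward backward
  where
  open RealNumbers ℝ hiding (zero)
  open RealMatrices ℝ

  Conjugation : Set _
  Conjugation = (∀ i j → i ≢ j → 0# < (φ ⟦ J-I n ⟧) i j) ×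
    (∃ λ (P : Matrix n n) → IsPermutationMatrix P ×
      (∀ X → φ ⟦ X ⟧ ≈ₘ φ ⟦ J-I n ⟧ ∘ₘ (P ᵀ *ₘ matrix X *ₘ P)))

  forward : (∀ X → α (φ ⟦ X ⟧) ≡ α (matrix X)) → Conjugation
  forward preserves =
    φ-J-I-positive ℝ φ linear preserves ,
    P , (π , λ i j → refl) , λ X i j →
      trans (φ-conjugate ℝ φ linear preserves X i j)
        (*-congˡ (sym (permutation-conjugate ℝ P (matrix X) π (λ _ _ → refl) i j)))
    where
    π = σ ℝ φ linear preserves
    P : Matrix n n
    -- Row `i` has its one in column `π ⟨$⟩ʳ i`, so conjugation reads `X` at preimages under `π`, as
    -- `φ-conjugate` does.
    P i j = δ (π ⟨$⟩ʳ i) j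

  backward : Conjugation → ∀ X → α (φ ⟦ X ⟧) ≡ α (matrix X)
  backward (H>0 , P , (π , P≈δ) , φ≈) = conjugate⇒preserves ℝ φ linear H>0 π λ X i j →
    trans (φ≈ X i j) (*-congˡ (permutation-conjugate ℝ P (matrix X) π P≈δ i j))
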